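{- Let $T$ be a tree of order $n\geq 2$ and let $w$ be a normalised weight function on $E(T)$. Then $$\mathrm{avec}(T,w)\leq n-1.$$ Equality holds if and only if there exists an edge $e$ of $T$ with $w(e)=n-1$.
   Context: Graphs are finite and simple; the order is the number of vertices. For a connected graph $G$ with $n$ vertices and $m$ edges, a weight function is a map $w:E(G)\to\mathbb{R}^{\geq 0}$; it is called normalised if $\sum_{e\in E(G)}w(e)=m$ (so for a tree on $n$ vertices the total weight is $n-1$). The weighted distance $d_w(u,v)$ is the minimum, over all paths between $u$ and $v$ in $G$, of the sum of the weights of the edges of the path. The weighted eccentricity of a vertex $v$ is $e_w(v)=\max_{u\in V(G)}d_w(u,v)$, and the average eccentricity is $\mathrm{avec}(G,w)=\frac1n\sum_{v\in V(G)}e_w(v)$. -}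

module Defs where

open import Data.Bool.Base using (Bool; false; T)
open import Data.Bool.Properties using (T?; T-irrelevant)
open import Data.Fin.Base as Fin using (Fin)
import Data.Fin.Properties as Fin
open import Data.Integer.Base as ℤ using (+_)
open import Data.List.Base
  using (List; []; _∷_; map; foldr; concatMap; length; lookup; allFin; upTo; cartesianProduct)
open import Data.List.Membership.Propositional using (_∈_; lose)
open import Data.List.Membership.Propositional.Properties
  using (∈-map⁺; ∈-concatMap⁺; ∈-upTo⁺; ∈-allFin; ∈-lookup; ∈-cartesianProduct⁺)
open import Data.List.NonEmpty.Base as List⁺ using (List⁺; _∷_)
import Data.List.Relation.Unary.All as All
open import Data.List.Relation.Unary.AllPairs using ([]; _∷_)
open import Data.List.Relation.Unary.Any using (here; there)
open import Data.List.Relation.Unary.Unique.DecPropositional using (unique?)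
open import Data.List.Relation.Unary.Unique.Propositional using (Unique)
open import Data.Nat.Base as ℕ using (ℕ; zero; suc; NonZero; z≤n; s≤s)
open import Data.Nat.Coprimality using (1-coprimeTo)
import Data.Nat.Properties as ℕ
open import Data.Product.Base using (∃; _×_; _,_; proj₁)
open import Data.Rational.Base as ℚ using (ℚ; 0ℚ; 1ℚ; ½; _/_; ∣_∣)
import Data.Rational.Properties as ℚ
open import Data.Sum.Base using (inj₁; inj₂)
open import Level using (0ℓ)
open import Relation.Binary.Definitions using (tri<; tri≈; tri>)
open import Relation.Binary.PropositionalEquality
  using (_≡_; refl; sym; trans; cong; cong₂; subst)
open import Relation.Nullary using (¬_; yes; no; contradiction)
open import Relation.Nullary.Decidable using (_×-dec_)
open import Relation.Unary using (Pred; Decidable)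

------------------------------------------------------------------------
-- Real numbers: Cauchy sequences of rationals, with _≈ℝ_ as equality.
-- The arithmetic operations act termwise.

record ℝ : Set where
  constructor mkℝ
  field
    seq    : ℕ → ℚ
    cauchy : ∀ ε → 0ℚ ℚ.< ε →
             ∃ λ N → ∀ i j → N ℕ.≤ i → N ℕ.≤ j → ∣ seq i ℚ.- seq j ∣ ℚ.≤ ε

open ℝ public

infix  4 _≤ℝ_ _≈ℝ_
infixl 6 _+ℝ_ _⊓ℝ_ _⊔ℝ_
infixl 7 _/ℝ_

_≤ℝ_ : ℝ → ℝ → Set
x ≤ℝ y = ∀ ε → 0ℚ ℚ.< ε →
         ∃ λ N → ∀ i → N ℕ.≤ i → seq x i ℚ.≤ seq y i ℚ.+ ε

_≈ℝ_ : ℝ → ℝ → Set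
x ≈ℝ y = ∀ ε → 0ℚ ℚ.< ε →
         ∃ λ N → ∀ i → N ℕ.≤ i → ∣ seq x i ℚ.- seq y i ∣ ℚ.≤ ε

module TermwiseOperations where

  p≤∣p∣ : ∀ p → p ℚ.≤ ∣ p ∣
  p≤∣p∣ p with ℚ.≤-total 0ℚ p
  ... | inj₁ 0≤p = ℚ.≤-reflexive (sym (ℚ.0≤p⇒∣p∣≡p 0≤p))
  ... | inj₂ p≤0 = ℚ.≤-trans p≤0 (ℚ.0≤∣p∣ p)

  [p-q]+q : ∀ p q → (p ℚ.- q) ℚ.+ q ≡ p
  [p-q]+q p q = trans (ℚ.+-assoc p (ℚ.- q) q)
               (trans (cong (p ℚ.+_) (ℚ.+-inverseˡ q)) (ℚ.+-identityʳ p))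

  [p+q]-p : ∀ p q → (p ℚ.+ q) ℚ.- p ≡ q
  [p+q]-p p q = trans (cong (ℚ._- p) (ℚ.+-comm p q))
               (trans (ℚ.+-assoc q p (ℚ.- p))
               (trans (cong (q ℚ.+_) (ℚ.+-inverseʳ p)) (ℚ.+-identityʳ q)))

  p≤q+∣p-q∣ : ∀ p q → p ℚ.≤ q ℚ.+ ∣ p ℚ.- q ∣
  p≤q+∣p-q∣ p q = begin
    p                    ≡⟨ [p-q]+q p q ⟨
    (p ℚ.- q) ℚ.+ q      ≤⟨ ℚ.+-monoˡ-≤ q (p≤∣p∣ (p ℚ.- q)) ⟩
    ∣ p ℚ.- q ∣ ℚ.+ q    ≡⟨ ℚ.+-comm _ q ⟩
    q ℚ.+ ∣ p ℚ.- q ∣    ∎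
    where open ℚ.≤-Reasoning

  -[p-q] : ∀ p q → ℚ.- (p ℚ.- q) ≡ q ℚ.- p
  -[p-q] p q = trans (ℚ.neg-distrib-+ p (ℚ.- q))
              (trans (cong (ℚ.- p ℚ.+_) (neg-neg q)) (ℚ.+-comm (ℚ.- p) q))
    where
    neg-neg : ∀ r → ℚ.- (ℚ.- r) ≡ r
    neg-neg r = trans (sym (ℚ.+-identityˡ _))
               (trans (cong (ℚ._+ ℚ.- (ℚ.- r)) (sym (ℚ.+-inverseʳ r)))
               (trans (ℚ.+-assoc r _ _)
               (trans (cong (r ℚ.+_) (ℚ.+-inverseʳ (ℚ.- r))) (ℚ.+-identityʳ r))))

  ∣p-q∣≡∣q-p∣ : ∀ p q → ∣ p ℚ.- q ∣ ≡ ∣ q ℚ.- p ∣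
  ∣p-q∣≡∣q-p∣ p q = trans (sym (ℚ.∣-p∣≡∣p∣ (p ℚ.- q))) (cong ∣_∣ (-[p-q] p q))

  p≤q+r⇒p-q≤r : ∀ p q r → p ℚ.≤ q ℚ.+ r → p ℚ.- q ℚ.≤ r
  p≤q+r⇒p-q≤r p q r h =
    ℚ.≤-trans (ℚ.+-monoˡ-≤ (ℚ.- q) h) (ℚ.≤-reflexive ([p+q]-p q r))

  ∣-∣-bound : ∀ p q r → p ℚ.≤ q ℚ.+ r → q ℚ.≤ p ℚ.+ r → ∣ p ℚ.- q ∣ ℚ.≤ r
  ∣-∣-bound p q r h k with ℚ.∣p∣≡p∨∣p∣≡-p (p ℚ.- q)
  ... | inj₁ eq = subst (ℚ._≤ r) (sym eq) (p≤q+r⇒p-q≤r p q r h)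
  ... | inj₂ eq = subst (ℚ._≤ r) (sym (trans eq (-[p-q] p q))) (p≤q+r⇒p-q≤r q p r k)

  half : ∀ ε → ε ℚ.* ½ ℚ.+ ε ℚ.* ½ ≡ ε
  half ε = trans (sym (ℚ.*-distribˡ-+ ε ½ ½)) (ℚ.*-identityʳ ε)

  0<half : ∀ {ε} → 0ℚ ℚ.< ε → 0ℚ ℚ.< ε ℚ.* ½
  0<half {ε} 0<ε = subst (ℚ._< ε ℚ.* ½) (ℚ.*-zeroˡ ½) (ℚ.*-monoˡ-<-pos ½ 0<ε)

  Nonexpansive : (ℚ → ℚ → ℚ) → Set
  Nonexpansive f = ∀ a b c d →
    f a b ℚ.≤ f c d ℚ.+ (∣ a ℚ.- c ∣ ℚ.+ ∣ b ℚ.- d ∣)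

  termwise : (f : ℚ → ℚ → ℚ) → Nonexpansive f → ℝ → ℝ → ℝ
  termwise f f-ne x y .seq i = f (seq x i) (seq y i)
  termwise f f-ne x y .cauchy ε 0<ε
    with cauchy x (ε ℚ.* ½) (0<half 0<ε) | cauchy y (ε ℚ.* ½) (0<half 0<ε)
  ... | M , hx | N , hy = M ℕ.⊔ N , bound
    where
    open ℚ.≤-Reasoning
    bound : ∀ i j → M ℕ.⊔ N ℕ.≤ i → M ℕ.⊔ N ℕ.≤ j →
            ∣ f (seq x i) (seq y i) ℚ.- f (seq x j) (seq y j) ∣ ℚ.≤ ε
    bound i j ≤i ≤j = begin
      ∣ f a b ℚ.- f c d ∣
        ≤⟨ ∣-∣-bound (f a b) (f c d) _ (f-ne a b c d)
             (subst (λ t → f c d ℚ.≤ f a b ℚ.+ t)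
                    (cong₂ ℚ._+_ (∣p-q∣≡∣q-p∣ c a) (∣p-q∣≡∣q-p∣ d b)) (f-ne c d a b)) ⟩
      ∣ a ℚ.- c ∣ ℚ.+ ∣ b ℚ.- d ∣
        ≤⟨ ℚ.+-mono-≤ (hx i j (ℕ.m⊔n≤o⇒m≤o M N ≤i) (ℕ.m⊔n≤o⇒m≤o M N ≤j))
                      (hy i j (ℕ.m⊔n≤o⇒n≤o M N ≤i) (ℕ.m⊔n≤o⇒n≤o M N ≤j)) ⟩
      ε ℚ.* ½ ℚ.+ ε ℚ.* ½
        ≡⟨ half ε ⟩
      ε ∎
      where
      a = seq x i
      b = seq y i
      c = seq x j
      d = seq y j

  p≤p+q : ∀ p {q} → 0ℚ ℚ.≤ q → p ℚ.≤ p ℚ.+ q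
  p≤p+q p {q} 0≤q = subst (ℚ._≤ p ℚ.+ q) (ℚ.+-identityʳ p) (ℚ.+-monoʳ-≤ p 0≤q)

  p≤q+p : ∀ p {q} → 0ℚ ℚ.≤ q → p ℚ.≤ q ℚ.+ p
  p≤q+p p {q} 0≤q = subst (ℚ._≤ q ℚ.+ p) (ℚ.+-identityˡ p) (ℚ.+-monoˡ-≤ p 0≤q)

  left : ∀ a c t → 0ℚ ℚ.≤ t → a ℚ.≤ c ℚ.+ (∣ a ℚ.- c ∣ ℚ.+ t)
  left a c t 0≤t = ℚ.≤-trans (p≤q+∣p-q∣ a c) (ℚ.+-monoʳ-≤ c (p≤p+q _ 0≤t))

  right : ∀ b d s → 0ℚ ℚ.≤ s → b ℚ.≤ d ℚ.+ (s ℚ.+ ∣ b ℚ.- d ∣)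
  right b d s 0≤s = ℚ.≤-trans (p≤q+∣p-q∣ b d) (ℚ.+-monoʳ-≤ d (p≤q+p _ 0≤s))

  +-ne : Nonexpansive ℚ._+_
  +-ne a b c d = begin
    a ℚ.+ b                                          ≤⟨ ℚ.+-mono-≤ (p≤q+∣p-q∣ a c) (p≤q+∣p-q∣ b d) ⟩
    (c ℚ.+ s) ℚ.+ (d ℚ.+ t)                          ≡⟨ ℚ.+-assoc c s _ ⟩
    c ℚ.+ (s ℚ.+ (d ℚ.+ t))                          ≡⟨ cong (c ℚ.+_) (ℚ.+-assoc s d t) ⟨
    c ℚ.+ ((s ℚ.+ d) ℚ.+ t)                          ≡⟨ cong (λ z → c ℚ.+ (z ℚ.+ t)) (ℚ.+-comm s d) ⟩
    c ℚ.+ ((d ℚ.+ s) ℚ.+ t)                          ≡⟨ cong (c ℚ.+_) (ℚ.+-assoc d s t) ⟩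
    c ℚ.+ (d ℚ.+ (s ℚ.+ t))                          ≡⟨ ℚ.+-assoc c d _ ⟨
    (c ℚ.+ d) ℚ.+ (s ℚ.+ t)                          ∎
    where
    open ℚ.≤-Reasoning
    s = ∣ a ℚ.- c ∣
    t = ∣ b ℚ.- d ∣

  ⊔-ne : Nonexpansive ℚ._⊔_
  ⊔-ne a b c d = ℚ.⊔-lub
    (ℚ.≤-trans (left a c _ (ℚ.0≤∣p∣ (b ℚ.- d))) (ℚ.+-monoˡ-≤ _ (ℚ.p≤p⊔q c d)))
    (ℚ.≤-trans (right b d _ (ℚ.0≤∣p∣ (a ℚ.- c))) (ℚ.+-monoˡ-≤ _ (ℚ.p≤q⊔p c d)))

  ⊓-ne : Nonexpansive ℚ._⊓_
  ⊓-ne a b c d with ℚ.⊓-sel c d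
  ... | inj₁ eq = subst (λ z → a ℚ.⊓ b ℚ.≤ z ℚ.+ (∣ a ℚ.- c ∣ ℚ.+ ∣ b ℚ.- d ∣))
    (sym eq) (ℚ.≤-trans (ℚ.p⊓q≤p a b) (left a c _ (ℚ.0≤∣p∣ (b ℚ.- d))))
  ... | inj₂ eq = subst (λ z → a ℚ.⊓ b ℚ.≤ z ℚ.+ (∣ a ℚ.- c ∣ ℚ.+ ∣ b ℚ.- d ∣))
    (sym eq) (ℚ.≤-trans (ℚ.p⊓q≤q a b) (right b d _ (ℚ.0≤∣p∣ (a ℚ.- c))))

  ∣p*r-q*r∣ : ∀ p q r .{{_ : ℚ.NonNegative r}} →
              ∣ p ℚ.* r ℚ.- q ℚ.* r ∣ ≡ ∣ p ℚ.- q ∣ ℚ.* r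
  ∣p*r-q*r∣ p q r = trans (cong ∣_∣ (trans (cong (p ℚ.* r ℚ.+_) (ℚ.neg-distribˡ-* q r))
                                   (sym (ℚ.*-distribʳ-+ r p (ℚ.- q)))))
                   (trans (ℚ.∣p*q∣≡∣p∣*∣q∣ (p ℚ.- q) r)
                          (cong (∣ p ℚ.- q ∣ ℚ.*_) (ℚ.0≤p⇒∣p∣≡p (ℚ.nonNegative⁻¹ r))))

  1/n≤1 : ∀ n .{{_ : NonZero n}} → + 1 / n ℚ.≤ 1ℚ
  1/n≤1 (suc n) = subst (ℚ._≤ 1ℚ) (sym (ℚ.normalize-coprime (1-coprimeTo (suc n))))
                    (ℚ.*≤* (ℤ.+≤+ (s≤s z≤n)))

open TermwiseOperations using (termwise; +-ne; ⊔-ne; ⊓-ne; ∣p*r-q*r∣; 1/n≤1)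

_+ℝ_ _⊔ℝ_ _⊓ℝ_ : ℝ → ℝ → ℝ
_+ℝ_ = termwise ℚ._+_ +-ne
_⊔ℝ_ = termwise ℚ._⊔_ ⊔-ne
_⊓ℝ_ = termwise ℚ._⊓_ ⊓-ne

_/ℝ_ : ℝ → (n : ℕ) .{{_ : NonZero n}} → ℝ
(x /ℝ n) .seq i = seq x i ℚ.* (+ 1 / n)
(x /ℝ n) .cauchy ε 0<ε with cauchy x ε 0<ε
... | N , h = N , λ i j N≤i N≤j → begin
  ∣ seq x i ℚ.* (+ 1 / n) ℚ.- seq x j ℚ.* (+ 1 / n) ∣
    ≡⟨ ∣p*r-q*r∣ (seq x i) (seq x j) (+ 1 / n) {{ℚ.normalize-nonNeg 1 n}} ⟩
  ∣ seq x i ℚ.- seq x j ∣ ℚ.* (+ 1 / n)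
    ≤⟨ ℚ.*-monoˡ-≤-nonNeg ∣ seq x i ℚ.- seq x j ∣ {{ℚ.∣-∣-nonNeg (seq x i ℚ.- seq x j)}} (1/n≤1 n) ⟩
  ∣ seq x i ℚ.- seq x j ∣ ℚ.* 1ℚ
    ≡⟨ ℚ.*-identityʳ _ ⟩
  ∣ seq x i ℚ.- seq x j ∣
    ≤⟨ h i j N≤i N≤j ⟩
  ε ∎
  where open ℚ.≤-Reasoning

fromℕ : ℕ → ℝ
fromℕ n .seq    _     = + n / 1
fromℕ n .cauchy ε 0<ε = 0 , λ _ _ _ _ →
  subst (ℚ._≤ ε) (sym (cong ∣_∣ (ℚ.+-inverseʳ (+ n / 1)))) (ℚ.<⇒≤ 0<ε)

sumℝ : List ℝ → ℝ
sumℝ = foldr _+ℝ_ (fromℕ 0)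

maxℝ minℝ : List⁺ ℝ → ℝ
maxℝ (x ∷ xs) = foldr _⊔ℝ_ x xs
minℝ (x ∷ xs) = foldr _⊓ℝ_ x xs

------------------------------------------------------------------------
-- Finite simple graphs of order n

record Graph (n : ℕ) : Set where
  field
    adjacent : Fin n → Fin n → Bool
    symm     : ∀ u v → adjacent u v ≡ adjacent v u
    irrefl   : ∀ v → adjacent v v ≡ false

  Adj : Fin n → Fin n → Set
  Adj u v = T (adjacent u v)

  Adj-sym : ∀ {u v} → Adj u v → Adj v u
  Adj-sym {u} {v} = subst T (symm u v)

  ¬Adj-refl : ∀ {v} → ¬ Adj v v
  ¬Adj-refl {v} = subst T (irrefl v)

open Graph public

select : {A : Set} {P : Pred A 0ℓ} → Decidable P → List A → List (∃ P)
select P? []       = []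
select P? (x ∷ xs) with P? x
... | yes p = (x , p) ∷ select P? xs
... | no  _ = select P? xs

module _ {n : ℕ} (G : Graph n) where

  -- Each edge is represented once, by its endpoints in increasing order.
  IsEdge : Fin n × Fin n → Set
  IsEdge (u , v) = u Fin.< v × Adj G u v

  isEdge? : Decidable IsEdge
  isEdge? (u , v) = u Fin.<? v ×-dec T? (adjacent G u v)

  Edge : Set
  Edge = ∃ IsEdge

  edges : List Edge
  edges = select isEdge? (cartesianProduct (allFin n) (allFin n))

  edgeOf : ∀ {u v} → Adj G u v → Edge
  edgeOf {u} {v} u~v with Fin.<-cmp u v
  ... | tri< u<v _ _  = (u , v) , u<v , u~v
  ... | tri≈ _ refl _ = contradiction u~v (¬Adj-refl G)
  ... | tri> _ _ v<u  = (v , u) , v<u , Adj-sym G u~v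

  data Walk : Fin n → Fin n → Set where
    []  : ∀ {u} → Walk u u
    _∷_ : ∀ {u v z} → Adj G u v → Walk v z → Walk u z

  vertices : ∀ {u v} → Walk u v → List (Fin n)
  vertices {u} []      = u ∷ []
  vertices {u} (_ ∷ p) = u ∷ vertices p

  walkEdges : ∀ {u v} → Walk u v → List Edge
  walkEdges []        = []
  walkEdges (u~v ∷ p) = edgeOf u~v ∷ walkEdges p

  IsPath : ∀ {u v} → Walk u v → Set
  IsPath p = Unique (vertices p)

  isPath? : ∀ {u v} → Decidable (IsPath {u} {v})
  isPath? p = unique? Fin._≟_ (vertices p)

  Path : Fin n → Fin n → Set
  Path u v = ∃ (IsPath {u} {v})

  pathEdges : ∀ {u v} → Path u v → List Edge
  pathEdges (p , _) = walkEdges p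

  Connected : Set
  Connected = ∀ u v → Path u v

  -- A cycle is a path with at least two edges together with an edge
  -- joining its endpoints.
  Acyclic : Set
  Acyclic = ∀ {u v} (p : Path u v) → 2 ℕ.≤ length (pathEdges p) → ¬ Adj G v u

  record IsTree : Set where
    field
      connected : Connected
      acyclic   : Acyclic

  prepend : ∀ {z v} u → List (Walk z v) → List (Walk u v)
  prepend {z} u ps with T? (adjacent G u z)
  ... | yes u~z = map (u~z ∷_) ps
  ... | no  _   = []

  walksOfLength : ℕ → ∀ u v → List (Walk u v)
  walksOfLength zero u v with u Fin.≟ v
  ... | yes refl = [] ∷ []
  ... | no  _    = []
  walksOfLength (suc k) u v =
    concatMap (λ z → prepend u (walksOfLength k z v)) (allFin n)

  -- A path has distinct vertices, hence fewer than n edges; see ∈-paths.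
  paths : ∀ u v → List (Path u v)
  paths u v = select isPath? (concatMap (λ k → walksOfLength k u v) (upTo n))

  record WeightFunction : Set where
    field
      weight : Edge → ℝ
      nonNeg : ∀ e → fromℕ 0 ≤ℝ weight e

  open WeightFunction public

  totalWeight : WeightFunction → ℝ
  totalWeight w = sumℝ (map (weight w) edges)

  Normalised : WeightFunction → Set
  Normalised w = totalWeight w ≈ℝ fromℕ (length edges)

  pathWeight : WeightFunction → ∀ {u v} → Path u v → ℝ
  pathWeight w p = sumℝ (map (weight w) (pathEdges p))

  -- Connectedness makes the list of paths visibly nonempty.  The path it
  -- provides is among `paths` already, so it does not affect the minimum;
  -- likewise for the repeated vertex v in `ecc`.
  dist : Connected → WeightFunction → Fin n → Fin n → ℝ
  dist conn w u v = minℝ (List⁺.map (pathWeight w) (conn u v ∷ paths u v))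

  ecc : Connected → WeightFunction → Fin n → ℝ
  ecc conn w v = maxℝ (List⁺.map (λ u → dist conn w u v) (v ∷ allFin n))

  avec : .{{_ : NonZero n}} → Connected → WeightFunction → ℝ
  avec conn w = sumℝ (map (ecc conn w) (allFin n)) /ℝ n

open IsTree public

------------------------------------------------------------------------
-- The enumerations of edges and paths are exhaustive.

∈-select : {A : Set} {P : Pred A 0ℓ} (P? : Decidable P) {x : A} {xs : List A} →
           P x → x ∈ xs → ∃ λ p → (x , p) ∈ select P? xs
∈-select P? {x} {y ∷ xs} px (here refl) with P? y
... | yes p = p , here refl
... | no ¬p = contradiction px ¬p
∈-select P? {x} {y ∷ xs} px (there x∈xs) with P? y | ∈-select P? px x∈xs
... | yes _ | p , m = p , there m
... | no  _ | p , m = p , m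

module _ {n : ℕ} (G : Graph n) where

  ∈-edges : (e : Edge G) → e ∈ edges G
  ∈-edges (uv@(u , v) , u<v , u~v)
    with ∈-select (isEdge? G) (u<v , u~v)
           (∈-cartesianProduct⁺ (∈-allFin u) (∈-allFin v))
  ... | (u<v′ , u~v′) , m = subst (_∈ edges G)
    (cong (uv ,_) (cong₂ _,_ (Fin.<-irrelevant u<v′ u<v) (T-irrelevant u~v′ u~v))) m

  ∈-walksOfLength : ∀ {u v} (p : Walk G u v) →
                    p ∈ walksOfLength G (length (walkEdges G p)) u v
  ∈-walksOfLength {u} [] with u Fin.≟ u
  ... | yes refl = here refl
  ... | no u≢u = contradiction refl u≢u
  ∈-walksOfLength {u} (_∷_ {v = z} u~z p) =
    ∈-concatMap⁺ _ (lose (∈-allFin z) (∈-prepend (∈-walksOfLength p)))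
    where
    ∈-prepend : ∀ {v} {q : Walk G z v} {qs} → q ∈ qs → (u~z ∷ q) ∈ prepend G u qs
    ∈-prepend q∈qs with T? (adjacent G u z)
    ... | yes u~z′ rewrite T-irrelevant u~z u~z′ = ∈-map⁺ _ q∈qs
    ... | no ¬u~z = contradiction u~z ¬u~z

  length-vertices : ∀ {u v} (p : Walk G u v) →
                    length (vertices G p) ≡ suc (length (walkEdges G p))
  length-vertices []      = refl
  length-vertices (_ ∷ p) = cong suc (length-vertices p)

  lookup-injective : {xs : List (Fin n)} → Unique xs →
                     ∀ i j → lookup xs i ≡ lookup xs j → i ≡ j
  lookup-injective (_ ∷ _)  Fin.zero    Fin.zero    _  = refl
  lookup-injective (x≢ ∷ _) Fin.zero    (Fin.suc j) eq =
    contradiction eq (All.lookup x≢ (∈-lookup j))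
  lookup-injective (x≢ ∷ _) (Fin.suc i) Fin.zero    eq =
    contradiction (sym eq) (All.lookup x≢ (∈-lookup i))
  lookup-injective (_ ∷ u)  (Fin.suc i) (Fin.suc j) eq =
    cong Fin.suc (lookup-injective u i j eq)

  pathLength<n : ∀ {u v} (p : Path G u v) → length (pathEdges G p) ℕ.< n
  pathLength<n (p , uniq) = subst (ℕ._≤ n) (length-vertices p)
    (Fin.injective⇒≤ (λ {i} {j} → lookup-injective uniq i j))

  -- Up to the proof of distinctness, which need not be unique.
  ∈-paths : ∀ {u v} (p : Path G u v) → ∃ λ isPath → (proj₁ p , isPath) ∈ paths G u v
  ∈-paths p@(q , isPath) = ∈-select (isPath? G) isPath
    (∈-concatMap⁺ _ (lose (∈-upTo⁺ (pathLength<n p)) (∈-walksOfLength q)))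

{-# OPTIONS --safe #-}
module Submission where

-- Upper bound.  A tree of order n has n - 1 edges, so the total weight is
-- n - 1.  The distance from u to v is at most the weight of a path from u to v,
-- and the edges of a path are distinct, so every eccentricity, and hence their
-- average, is at most the total weight.
--
-- Everything about trees comes from one fact (bridge): if a and b are adjacent,
-- then every walk from a to b uses the edge ab, because a walk avoiding it
-- contains a path that closes up to a cycle.  In the form used most (bridge₂),
-- no vertex v is reached from both a and b by walks that avoid ab.
--
-- Number of edges (∣edges∣).  Fix a root.  Sending each other vertex to the
-- first edge of its path to the root is a bijection onto the edges: it is
-- injective by bridge₂, and surjective since the path to the root from one end
-- of an edge must start with that edge, again by bridge₂.
--
-- An edge e of weight n - 1 gives equality (weight≼avec).  Given v, some end u
-- of e has the property that all paths from u to v use e (far-end).  Hence the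
-- eccentricity of v is at least the weight of e.
--
-- Equality gives an edge of weight n - 1 (heavy-edge).  Let e and f be distinct
-- edges.  Some end v of e is such that none of the chosen paths to v uses both
-- e and f (separating-end), so the eccentricity of v falls short of n - 1 by at
-- least m = min (w e) (w f).  If the average is n - 1, no eccentricity can fall
-- short by a positive amount, so m ≤ 0 (min-weight≼0).  The total weight is
-- positive, so some edge e has a weight that is bounded away from 0; this is
-- found constructively, since a sum of two reals is positive only if one of them
-- can be shown to be (Positive-split).  Then all the other edges have weight 0,
-- and e carries the total weight.

open import Data.Bool.Properties using (T-irrelevant)
open import Data.Fin.Base using (Fin; zero; suc)
import Data.Fin.Properties as Fin
open import Data.Integer.Base as ℤ using (+_)
import Data.Integer.Properties as ℤ
open import Data.List.Base
  using (List; []; _∷_; map; foldr; length; lookup; allFin; cartesianProduct)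
import Data.List.Membership.DecPropositional as DecMembership
open import Data.List.Membership.Propositional using (_∈_; _∉_; find)
open import Data.List.Membership.Propositional.Properties using (∈-lookup; ∈-allFin)
open import Data.List.NonEmpty.Base as List⁺ using (_∷_)
open import Data.List.Properties using (length-tabulate)
open import Data.List.Relation.Binary.Subset.Propositional using (_⊆_)
open import Data.List.Relation.Unary.All as All using (All; []; _∷_)
open import Data.List.Relation.Unary.All.Properties using (¬All⇒Any¬)
open import Data.List.Relation.Unary.AllPairs using ([]; _∷_)
open import Data.List.Relation.Unary.Any using (here; there; index; _─_)
open import Data.List.Relation.Unary.Any.Properties using (lookup-index)
open import Data.List.Relation.Unary.Unique.Propositional using (Unique)
open import Data.List.Relation.Unary.Unique.Propositional.Properties
  using (allFin⁺; cartesianProduct⁺)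
open import Data.Nat.Base as ℕ using (ℕ; zero; suc; NonZero; _≤_; _∸_; z≤n; s≤s)
import Data.Nat.Properties as ℕ
open import Data.Product.Base using (∃; Σ-syntax; _×_; _,_; proj₁; proj₂; map₂)
open import Data.Product.Properties using (≡-dec)
open import Data.Rational.Base as ℚ using (ℚ; 0ℚ; 1ℚ; ½; _/_)
import Data.Rational.Properties as ℚ
open import Data.Rational.Solver using (module +-*-Solver)
import Data.Rational.Unnormalised.Base as ℚᵘ
import Data.Rational.Unnormalised.Properties as ℚᵘ
open import Data.Sum.Base using (_⊎_; inj₁; inj₂; [_,_]′)
open import Function.Base using (id)
open import Function.Bundles using (_⇔_; mk⇔)
open import Level using (0ℓ)
open import Relation.Binary.Bundles using (Preorder)
open import Relation.Binary.Definitions using (DecidableEquality; tri<; tri≈; tri>)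
open import Relation.Binary.PropositionalEquality
  using (_≡_; _≢_; refl; sym; trans; cong; cong₂; subst; isEquivalence; module ≡-Reasoning)
import Relation.Binary.Reasoning.Preorder as PreorderReasoning
open import Relation.Nullary using (¬_; Dec; yes; no; contradiction)
open import Relation.Nullary.Decidable using (map′; _×-dec_; decidable-stable)
open import Relation.Unary using (Pred; Decidable)
open import Defs
open TermwiseOperations
  using (p≤q+∣p-q∣; ∣p-q∣≡∣q-p∣; ∣-∣-bound; p≤q+r⇒p-q≤r; [p+q]-p; p≤p+q; half; 0<half; 1/n≤1)

------------------------------------------------------------------------
-- The order of the real numbers

private
  variable
    A : Set
    x y z x′ y′ : ℝ
    P Q R : ℕ → Set

0ℝ : ℝ
0ℝ = fromℕ 0

-- The property holds for all sufficiently large indices.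
Eventually : (ℕ → Set) → Set
Eventually P = ∃ λ N → ∀ i → N ℕ.≤ i → P i

ev-map : (∀ i → P i → Q i) → Eventually P → Eventually Q
ev-map f (N , h) = N , λ i N≤i → f i (h i N≤i)

ev-zip : (∀ i → P i → Q i → R i) → Eventually P → Eventually Q → Eventually R
ev-zip f (M , g) (N , h) = M ℕ.⊔ N , λ i le →
  f i (g i (ℕ.m⊔n≤o⇒m≤o M N le)) (h i (ℕ.m⊔n≤o⇒n≤o M N le))

-- _≤ℝ_ as a record, so that the endpoints x and y can be inferred from a proof
-- of x ≼ y.  Endpoints that are sums are still given explicitly below: inferring
-- the summands would compare the moduli of convergence of the sums.
infix 4 _≼_
record _≼_ (x y : ℝ) : Set where
  constructor mk≼
  field ≼⇒≤ : x ≤ℝ y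
open _≼_

termwise⇒≼ : (∀ i → seq x i ℚ.≤ seq y i) → x ≼ y
termwise⇒≼ h = mk≼ λ ε 0<ε → 0 , λ i _ → ℚ.≤-trans (h i) (p≤p+q _ (ℚ.<⇒≤ 0<ε))

termwise-≡⇒≼ : (∀ i → seq x i ≡ seq y i) → x ≼ y
termwise-≡⇒≼ h = termwise⇒≼ (λ i → ℚ.≤-reflexive (h i))

≼-refl : x ≼ x
≼-refl = termwise-≡⇒≼ (λ _ → refl)

≼-trans : x ≼ y → y ≼ z → x ≼ z
≼-trans {x} {y} {z} (mk≼ x≤y) (mk≼ y≤z) = mk≼ λ ε 0<ε →
  let η = ε ℚ.* ½ in
  ev-zip (λ i h k → let open ℚ.≤-Reasoning in begin
      seq x i                    ≤⟨ h ⟩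
      seq y i ℚ.+ η              ≤⟨ ℚ.+-monoˡ-≤ η k ⟩
      (seq z i ℚ.+ η) ℚ.+ η      ≡⟨ ℚ.+-assoc (seq z i) η η ⟩
      seq z i ℚ.+ (η ℚ.+ η)      ≡⟨ cong (seq z i ℚ.+_) (half ε) ⟩
      seq z i ℚ.+ ε              ∎)
    (x≤y η (0<half 0<ε)) (y≤z η (0<half 0<ε))

≼-preorder : Preorder 0ℓ 0ℓ 0ℓ
≼-preorder = record
  { Carrier    = ℝ
  ; _≈_        = _≡_
  ; _≲_        = _≼_
  ; isPreorder = record
    { isEquivalence = isEquivalence
    ; reflexive     = λ { refl → ≼-refl }
    ; trans         = ≼-trans
    }
  }

module ≼-Reasoning = PreorderReasoning ≼-preorder

≈⇒≼ : x ≈ℝ y → x ≼ y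
≈⇒≼ {x} {y} x≈y = mk≼ λ ε 0<ε → ev-map
  (λ i h → ℚ.≤-trans (p≤q+∣p-q∣ (seq x i) (seq y i)) (ℚ.+-monoʳ-≤ (seq y i) h)) (x≈y ε 0<ε)

≈⇒≽ : x ≈ℝ y → y ≼ x
≈⇒≽ {x} {y} x≈y = ≈⇒≼ λ ε 0<ε →
  ev-map (λ i → subst (ℚ._≤ ε) (∣p-q∣≡∣q-p∣ (seq x i) (seq y i))) (x≈y ε 0<ε)

≼-antisym : x ≼ y → y ≼ x → x ≈ℝ y
≼-antisym (mk≼ x≤y) (mk≼ y≤x) ε 0<ε =
  ev-zip (λ i → ∣-∣-bound _ _ ε) (x≤y ε 0<ε) (y≤x ε 0<ε)

+-mono-≼ : x ≼ x′ → y ≼ y′ → x +ℝ y ≼ x′ +ℝ y′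
+-mono-≼ {x} {x′} {y} {y′} (mk≼ h) (mk≼ k) = mk≼ λ ε 0<ε →
  let η = ε ℚ.* ½ in
  ev-zip (λ i h k → let open ℚ.≤-Reasoning in begin
      seq x i ℚ.+ seq y i                     ≤⟨ ℚ.+-mono-≤ h k ⟩
      (seq x′ i ℚ.+ η) ℚ.+ (seq y′ i ℚ.+ η)
        ≡⟨ solve 3 (λ a b e → (a :+ e) :+ (b :+ e) := (a :+ b) :+ (e :+ e))
             refl (seq x′ i) (seq y′ i) η ⟩
      (seq x′ i ℚ.+ seq y′ i) ℚ.+ (η ℚ.+ η)
        ≡⟨ cong ((seq x′ i ℚ.+ seq y′ i) ℚ.+_) (half ε) ⟩
      (seq x′ i ℚ.+ seq y′ i) ℚ.+ ε           ∎)
    (h η (0<half 0<ε)) (k η (0<half 0<ε))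
  where open +-*-Solver

+-comm-≼ : ∀ x y → x +ℝ y ≼ y +ℝ x
+-comm-≼ x y = termwise-≡⇒≼ (λ i → ℚ.+-comm (seq x i) (seq y i))

+-identityˡ-≼ : ∀ x → 0ℝ +ℝ x ≼ x
+-identityˡ-≼ x = termwise-≡⇒≼ (λ i → ℚ.+-identityˡ (seq x i))

+-identityˡ-≽ : ∀ x → x ≼ 0ℝ +ℝ x
+-identityˡ-≽ x = termwise-≡⇒≼ (λ i → sym (ℚ.+-identityˡ (seq x i)))

+-assoc-≼ : ∀ x y z → (x +ℝ y) +ℝ z ≼ x +ℝ (y +ℝ z)
+-assoc-≼ x y z = termwise-≡⇒≼ (λ i → ℚ.+-assoc (seq x i) (seq y i) (seq z i))

+-cancel-≤ : ∀ p q r → p ℚ.+ q ℚ.≤ p ℚ.+ r → q ℚ.≤ r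
+-cancel-≤ p q r h = subst (ℚ._≤ r) ([p+q]-p p q) (p≤q+r⇒p-q≤r (p ℚ.+ q) p r h)

+-cancelˡ-≼ : ∀ x y z → x +ℝ y ≼ x +ℝ z → y ≼ z
+-cancelˡ-≼ x y z (mk≼ h) = mk≼ λ ε 0<ε → ev-map
  (λ i h → +-cancel-≤ (seq x i) (seq y i) (seq z i ℚ.+ ε)
    (subst (seq x i ℚ.+ seq y i ℚ.≤_) (ℚ.+-assoc (seq x i) (seq z i) ε) h))
  (h ε 0<ε)

------------------------------------------------------------------------
-- Division by a positive natural number

/-mono-≼ : ∀ n .{{_ : NonZero n}} → x ≼ y → x /ℝ n ≼ y /ℝ n
/-mono-≼ {x} {y} n (mk≼ h) = mk≼ λ ε 0<ε → ev-map
  (λ i h → let open ℚ.≤-Reasoning in begin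
    seq x i ℚ.* r                    ≤⟨ ℚ.*-monoʳ-≤-nonNeg r {{r≥0}} h ⟩
    (seq y i ℚ.+ ε) ℚ.* r            ≡⟨ ℚ.*-distribʳ-+ r (seq y i) ε ⟩
    seq y i ℚ.* r ℚ.+ ε ℚ.* r
      ≤⟨ ℚ.+-monoʳ-≤ (seq y i ℚ.* r)
           (ℚ.*-monoˡ-≤-nonNeg ε {{ℚ.nonNegative (ℚ.<⇒≤ 0<ε)}} (1/n≤1 n)) ⟩
    seq y i ℚ.* r ℚ.+ ε ℚ.* 1ℚ       ≡⟨ cong (seq y i ℚ.* r ℚ.+_) (ℚ.*-identityʳ ε) ⟩
    seq y i ℚ.* r ℚ.+ ε              ∎)
  (h ε 0<ε)
  where
  r = + 1 / n
  r≥0 = ℚ.normalize-nonNeg 1 n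

/-cancel-≼ : ∀ n .{{_ : NonZero n}} → x /ℝ n ≼ y /ℝ n → x ≼ y
/-cancel-≼ {x} {y} n (mk≼ h) = mk≼ λ ε 0<ε → ev-map
  (λ i h → ℚ.*-cancelʳ-≤-pos r {{r>0}} (subst (seq x i ℚ.* r ℚ.≤_)
    (sym (ℚ.*-distribʳ-+ r (seq y i) ε)) h))
  (h (ε ℚ.* r) (subst (ℚ._< ε ℚ.* r) (ℚ.*-zeroˡ r) (ℚ.*-monoˡ-<-pos r {{r>0}} 0<ε)))
  where
  r = + 1 / n
  r>0 = ℚ.normalize-pos 1 n

------------------------------------------------------------------------
-- Maxima and minima

⊔-elim : (S : ℚ → Set) → ∀ p q → S p → S q → S (p ℚ.⊔ q)
⊔-elim S p q sp sq with ℚ.⊔-sel p q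
... | inj₁ eq = subst S (sym eq) sp
... | inj₂ eq = subst S (sym eq) sq

⊓-elim : (S : ℚ → Set) → ∀ p q → S p → S q → S (p ℚ.⊓ q)
⊓-elim S p q sp sq with ℚ.⊓-sel p q
... | inj₁ eq = subst S (sym eq) sp
... | inj₂ eq = subst S (sym eq) sq

-- Least upper bound, up to a common summand m.
⊔-lub-+ : ∀ {m c} x y → x +ℝ m ≼ c → y +ℝ m ≼ c → (x ⊔ℝ y) +ℝ m ≼ c
⊔-lub-+ {m} {c} x y (mk≼ h) (mk≼ k) = mk≼ λ ε 0<ε → ev-zip
  (λ i → ⊔-elim (λ q → q ℚ.+ seq m i ℚ.≤ seq c i ℚ.+ ε) (seq x i) (seq y i))
  (h ε 0<ε) (k ε 0<ε)

⊓-glb : ∀ x y → z ≼ x → z ≼ y → z ≼ x ⊓ℝ y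
⊓-glb {z} x y (mk≼ h) (mk≼ k) = mk≼ λ ε 0<ε → ev-zip
  (λ i → ⊓-elim (λ q → seq z i ℚ.≤ q ℚ.+ ε) (seq x i) (seq y i))
  (h ε 0<ε) (k ε 0<ε)

x⊓y≼x : ∀ x y → x ⊓ℝ y ≼ x
x⊓y≼x x y = termwise⇒≼ (λ i → ℚ.p⊓q≤p (seq x i) (seq y i))

x⊓y≼y : ∀ x y → x ⊓ℝ y ≼ y
x⊓y≼y x y = termwise⇒≼ (λ i → ℚ.p⊓q≤q (seq x i) (seq y i))

x≼x⊔y : ∀ x y → x ≼ x ⊔ℝ y
x≼x⊔y x y = termwise⇒≼ (λ i → ℚ.p≤p⊔q (seq x i) (seq y i))

y≼x⊔y : ∀ x y → y ≼ x ⊔ℝ y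
y≼x⊔y x y = termwise⇒≼ (λ i → ℚ.p≤q⊔p (seq x i) (seq y i))

module _ (f : A → ℝ) (a : A) where

  private
    max min : List A → ℝ
    max as = maxℝ (List⁺.map f (a ∷ as))
    min as = minℝ (List⁺.map f (a ∷ as))

  max-lub-+ : ∀ m c → (∀ b → f b +ℝ m ≼ c) → ∀ as → max as +ℝ m ≼ c
  max-lub-+ m c h []       = h a
  max-lub-+ m c h (b ∷ bs) = ⊔-lub-+ {m} {c} (f b) (max bs) (h b) (max-lub-+ m c h bs)

  ≼max : ∀ {b} as → b ∈ as → f b ≼ max as
  ≼max (b ∷ bs) (here refl)  = x≼x⊔y (f b) (max bs)
  ≼max (b ∷ bs) (there b∈bs) = ≼-trans {y = max bs} (≼max bs b∈bs) (y≼x⊔y (f b) (max bs))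

  min≼head : ∀ as → min as ≼ f a
  min≼head []       = ≼-refl {f a}
  min≼head (b ∷ bs) = ≼-trans {y = min bs} (x⊓y≼y (f b) (min bs)) (min≼head bs)

  min-glb : z ≼ f a → ∀ as → All (λ b → z ≼ f b) as → z ≼ min as
  min-glb h []       []       = h
  min-glb h (b ∷ bs) (k ∷ ks) = ⊓-glb (f b) (min bs) k (min-glb h bs ks)

------------------------------------------------------------------------
-- Finite sums in a preordered commutative monoid

∈-─ : ∀ {a b : A} {as} (a∈as : a ∈ as) → b ∈ as → a ≢ b → b ∈ (as ─ a∈as)
∈-─ (here refl)  (here refl)  a≢b = contradiction refl a≢b
∈-─ (here refl)  (there b∈as) a≢b = b∈as
∈-─ (there a∈as) (here refl)  a≢b = here refl
∈-─ (there a∈as) (there b∈as) a≢b = there (∈-─ a∈as b∈as a≢b)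

-- Sums of finite lists.  The laws are stated as inequalities, in one direction
-- where commutativity yields the other: as sequences with moduli, the two sides
-- of a law for the reals need not be equal.
module PreorderedCommutativeMonoid
  {M : Set} (_⊑_ : M → M → Set) (_∙_ : M → M → M) (ε : M)
  (⊑-refl : ∀ {x} → x ⊑ x)
  (⊑-trans : ∀ {x y z} → x ⊑ y → y ⊑ z → x ⊑ z)
  (∙-mono : ∀ {x x′ y y′} → x ⊑ x′ → y ⊑ y′ → (x ∙ y) ⊑ (x′ ∙ y′))
  (∙-comm : ∀ x y → (x ∙ y) ⊑ (y ∙ x))
  (∙-assoc : ∀ x y z → ((x ∙ y) ∙ z) ⊑ (x ∙ (y ∙ z)))
  (∙-identityˡ-⊑ : ∀ x → (ε ∙ x) ⊑ x)
  (∙-identityˡ-⊒ : ∀ x → x ⊑ (ε ∙ x))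
  where

  private
    infixr 2 _⟫_

    -- Transitivity, written as composition in diagram order.
    _⟫_ : ∀ {x y z} → x ⊑ y → y ⊑ z → x ⊑ z
    _⟫_ = ⊑-trans

  sum : (A → M) → List A → M
  sum f as = foldr _∙_ ε (map f as)

  ∙-monoˡ : ∀ {x y} z → x ⊑ y → (x ∙ z) ⊑ (y ∙ z)
  ∙-monoˡ z h = ∙-mono h ⊑-refl

  ∙-monoʳ : ∀ {x y} z → x ⊑ y → (z ∙ x) ⊑ (z ∙ y)
  ∙-monoʳ z h = ∙-mono ⊑-refl h

  ∙-identityʳ-⊑ : ∀ x → (x ∙ ε) ⊑ x
  ∙-identityʳ-⊑ x = ∙-comm x ε ⟫ ∙-identityˡ-⊑ x

  ∙-identityʳ-⊒ : ∀ x → x ⊑ (x ∙ ε)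
  ∙-identityʳ-⊒ x = ∙-identityˡ-⊒ x ⟫ ∙-comm ε x

  ∙-swap : ∀ x y z → (x ∙ (y ∙ z)) ⊑ (y ∙ (x ∙ z))
  ∙-swap x y z = ∙-comm x (y ∙ z) ⟫ ∙-assoc y z x ⟫ ∙-monoʳ y (∙-comm z x)

  module _ {f g : A → M} (f⊑g : ∀ a → f a ⊑ g a) where

    sum-mono : ∀ as → sum f as ⊑ sum g as
    sum-mono []       = ⊑-refl
    sum-mono (a ∷ as) = ∙-mono (f⊑g a) (sum-mono as)

    -- If one of the summands of f falls short of that of g by m, so does the sum.
    sum-slack : ∀ m {a} as → a ∈ as → (f a ∙ m) ⊑ g a → (sum f as ∙ m) ⊑ sum g as
    sum-slack m (a ∷ as) (here refl) h =
      ∙-monoˡ m (∙-comm (f a) (sum f as)) ⟫ ∙-assoc (sum f as) (f a) m ⟫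
      ∙-mono (sum-mono as) h ⟫ ∙-comm (sum g as) (g a)
    sum-slack m (b ∷ bs) (there a∈bs) h =
      ∙-assoc (f b) (sum f bs) m ⟫ ∙-mono (f⊑g b) (sum-slack m bs a∈bs h)

  module _ (f : A → M) where

    -- A summand can be moved to the front.
    sum-pull : ∀ {a} as (a∈as : a ∈ as) → (f a ∙ sum f (as ─ a∈as)) ⊑ sum f as
    sum-pull     (a ∷ as) (here refl)  = ⊑-refl
    sum-pull {a} (b ∷ bs) (there a∈bs) =
      ∙-swap (f a) (f b) (sum f (bs ─ a∈bs)) ⟫ ∙-monoʳ (f b) (sum-pull bs a∈bs)

    sum⊑ε : ∀ {as} → All (λ a → f a ⊑ ε) as → sum f as ⊑ ε
    sum⊑ε []       = ⊑-refl
    sum⊑ε (h ∷ hs) = ∙-mono h (sum⊑ε hs) ⟫ ∙-identityˡ-⊑ ε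

    -- If all the terms other than f a are at most ε, the sum is at most f a.
    sum⊑term : ∀ {a as} → Unique as → a ∈ as → (∀ b → a ≢ b → f b ⊑ ε) → sum f as ⊑ f a
    sum⊑term {a} (a∉ ∷ _) (here refl) h =
      ∙-monoʳ (f a) (sum⊑ε (All.map (λ {b} → h b) a∉)) ⟫ ∙-identityʳ-⊑ (f a)
    sum⊑term {a} {b ∷ _} (b∉ ∷ uniq) (there a∈bs) h =
      ∙-mono (h b (λ a≡b → All.lookup b∉ a∈bs (sym a≡b))) (sum⊑term uniq a∈bs h) ⟫
      ∙-identityˡ-⊑ (f a)

    module _ (ε⊑f : ∀ a → ε ⊑ f a) where

      ε⊑sum : ∀ as → ε ⊑ sum f as
      ε⊑sum []       = ⊑-refl
      ε⊑sum (a ∷ as) = ∙-identityˡ-⊒ ε ⟫ ∙-mono (ε⊑f a) (ε⊑sum as)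

      -- A sum of nonnegative terms over distinct indices grows with the index set.
      sum-⊆ : ∀ as bs → Unique as → as ⊆ bs → sum f as ⊑ sum f bs
      sum-⊆ []       bs []          as⊆bs = ε⊑sum bs
      sum-⊆ (a ∷ as) bs (a∉ ∷ uniq) as⊆bs =
        ∙-monoʳ (f a) (sum-⊆ as (bs ─ a∈bs) uniq λ b∈as →
          ∈-─ a∈bs (as⊆bs (there b∈as)) (All.lookup a∉ b∈as)) ⟫
        sum-pull bs a∈bs
        where a∈bs = as⊆bs (here refl)

      term⊑sum : ∀ {a} as → a ∈ as → f a ⊑ sum f as
      term⊑sum {a} as a∈as =
        ∙-identityʳ-⊒ (f a) ⟫ sum-⊆ (a ∷ []) as ([] ∷ []) λ { (here refl) → a∈as }

open PreorderedCommutativeMonoid _≼_ _+ℝ_ 0ℝ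
  (λ {x} → ≼-refl {x}) (λ {x} {y} {z} → ≼-trans {x} {y} {z})
  (λ {x} {x′} {y} {y′} → +-mono-≼ {x} {x′} {y} {y′})
  +-comm-≼ +-assoc-≼ +-identityˡ-≼ +-identityˡ-≽
  public

------------------------------------------------------------------------
-- The average of a constant

suc-/1 : ∀ k → 1ℚ ℚ.+ + k / 1 ≡ + suc k / 1
suc-/1 k = ℚ.toℚᵘ-injective (begin
  ℚ.toℚᵘ (1ℚ ℚ.+ + k / 1)            ≈⟨ ℚ.toℚᵘ-homo-+ 1ℚ (+ k / 1) ⟩
  ℚᵘ.1ℚᵘ ℚᵘ.+ ℚ.toℚᵘ (+ k / 1)       ≈⟨ ℚᵘ.+-congʳ ℚᵘ.1ℚᵘ (ℚ.toℚᵘ-fromℚᵘ (ℚᵘ.mkℚᵘ (+ k) 0)) ⟩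
  ℚᵘ.1ℚᵘ ℚᵘ.+ ℚᵘ.mkℚᵘ (+ k) 0        ≈⟨ ℚᵘ.*≡* (cong (λ j → (+ 1 ℤ.+ j) ℤ.* + 1) (ℤ.*-identityʳ (+ k))) ⟩
  ℚᵘ.mkℚᵘ (+ suc k) 0                ≈⟨ ℚ.toℚᵘ-fromℚᵘ (ℚᵘ.mkℚᵘ (+ suc k) 0) ⟨
  ℚ.toℚᵘ (+ suc k / 1)               ∎)
  where open ℚᵘ.≃-Reasoning

n*1/n : ∀ n .{{_ : NonZero n}} → (+ n / 1) ℚ.* (+ 1 / n) ≡ 1ℚ
n*1/n n@(suc k) = ℚ.toℚᵘ-injective (begin
  ℚ.toℚᵘ ((+ n / 1) ℚ.* (+ 1 / n))              ≈⟨ ℚ.toℚᵘ-homo-* (+ n / 1) (+ 1 / n) ⟩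
  ℚ.toℚᵘ (+ n / 1) ℚᵘ.* ℚ.toℚᵘ (+ 1 / n)
    ≈⟨ ℚᵘ.*-cong (ℚ.toℚᵘ-fromℚᵘ (ℚᵘ.mkℚᵘ (+ n) 0)) (ℚ.toℚᵘ-fromℚᵘ (ℚᵘ.mkℚᵘ (+ 1) k)) ⟩
  ℚᵘ.mkℚᵘ (+ n) 0 ℚᵘ.* ℚᵘ.mkℚᵘ (+ 1) k
    ≈⟨ ℚᵘ.*≡* (trans (ℤ.*-identityʳ (+ n ℤ.* + 1)) (trans (ℤ.*-identityʳ (+ n))
      (sym (trans (ℤ.*-identityˡ _) (cong +_ (ℕ.*-identityˡ n)))))) ⟩
  ℚ.toℚᵘ 1ℚ                                     ∎)
  where open ℚᵘ.≃-Reasoning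

seq-sum-const : ∀ x (as : List A) i →
                seq (sumℝ (map (λ _ → x) as)) i ≡ (+ length as / 1) ℚ.* seq x i
seq-sum-const x []       i = sym (ℚ.*-zeroˡ (seq x i))
seq-sum-const x (a ∷ as) i = begin
  q ℚ.+ seq (sumℝ (map (λ _ → x) as)) i ≡⟨ cong (q ℚ.+_) (seq-sum-const x as i) ⟩
  q ℚ.+ k ℚ.* q                         ≡⟨ solve 2 (λ q k → q :+ k :* q := (con 1ℚ :+ k) :* q) refl q k ⟩
  (1ℚ ℚ.+ k) ℚ.* q                      ≡⟨ cong (ℚ._* q) (suc-/1 (length as)) ⟩
  (+ length (a ∷ as) / 1) ℚ.* q         ∎
  where
  open ≡-Reasoning
  open +-*-Solver
  q = seq x i
  k = + length as / 1

seq-avg-const : ∀ x n .{{_ : NonZero n}} (as : List A) → length as ≡ n → ∀ i →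
                seq (sumℝ (map (λ _ → x) as) /ℝ n) i ≡ seq x i
seq-avg-const x n as refl i = begin
  seq (sumℝ (map (λ _ → x) as)) i ℚ.* r  ≡⟨ cong (ℚ._* r) (seq-sum-const x as i) ⟩
  ((+ n / 1) ℚ.* q) ℚ.* r                ≡⟨ solve 3 (λ a b c → (a :* b) :* c := b :* (a :* c)) refl (+ n / 1) q r ⟩
  q ℚ.* ((+ n / 1) ℚ.* r)                ≡⟨ cong (q ℚ.*_) (n*1/n n) ⟩
  q ℚ.* 1ℚ                               ≡⟨ ℚ.*-identityʳ q ⟩
  q                                      ∎
  where
  open ≡-Reasoning
  open +-*-Solver
  q = seq x i
  r = + 1 / n

module _ (n : ℕ) .{{_ : NonZero n}} where

  avg-const-≼ : ∀ x → sum (λ (_ : Fin n) → x) (allFin n) /ℝ n ≼ x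
  avg-const-≼ x = termwise-≡⇒≼ (seq-avg-const x n (allFin n) (length-tabulate id))

  avg-const-≽ : ∀ x → x ≼ sum (λ (_ : Fin n) → x) (allFin n) /ℝ n
  avg-const-≽ x = termwise-≡⇒≼ (λ i → sym (seq-avg-const x n (allFin n) (length-tabulate id) i))

------------------------------------------------------------------------
-- Positive reals

-- Positivity in the constructive sense, with a rational lower bound for all late
-- terms; constructively this is stronger than the negation of x ≼ 0.
Positive : ℝ → Set
Positive x = ∃ λ δ → 0ℚ ℚ.< δ × Eventually (λ i → δ ℚ.≤ seq x i)

Positive-≼ : ∀ {x y} → Positive x → x ≼ y → Positive y
Positive-≼ {x} {y} (δ , 0<δ , ev) (mk≼ h) =
  η , 0<half 0<δ , ev-zip step ev (h η (0<half 0<δ))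
  where
  η = δ ℚ.* ½
  step : ∀ i → δ ℚ.≤ seq x i → seq x i ℚ.≤ seq y i ℚ.+ η → η ℚ.≤ seq y i
  step i p q = +-cancel-≤ η η (seq y i) (begin
    η ℚ.+ η          ≡⟨ half δ ⟩
    δ                ≤⟨ p ⟩
    seq x i          ≤⟨ q ⟩
    seq y i ℚ.+ η    ≡⟨ ℚ.+-comm (seq y i) η ⟩
    η ℚ.+ seq y i    ∎)
    where open ℚ.≤-Reasoning

Positive-fromℕ : ∀ k → Positive (fromℕ (suc k))
Positive-fromℕ k = + suc k / 1 , ℚ.positive⁻¹ _ {{ℚ.normalize-pos (suc k) 1}} , 0 , λ _ _ → ℚ.≤-refl

-- If x + y is eventually at least 4η, compare a late term of x with 2η: as x
-- varies by at most η from there on, x or y is eventually at least η.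
Positive-split-at : ∀ x y η → 0ℚ ℚ.< η →
  Eventually (λ i → (η ℚ.+ η) ℚ.+ (η ℚ.+ η) ℚ.≤ seq x i ℚ.+ seq y i) →
  Positive x ⊎ Positive y
Positive-split-at x y η 0<η (N , h) with cauchy x η 0<η
... | M , k with seq x (M ℕ.⊔ N) ℚ.≤? η ℚ.+ η
...   | no x≰2η = inj₁ (η , 0<η , K , λ i K≤i → +-cancel-≤ η η (seq x i) (begin
    η ℚ.+ η                                  <⟨ ℚ.≰⇒> x≰2η ⟩
    seq x K                                  ≤⟨ p≤q+∣p-q∣ (seq x K) (seq x i) ⟩
    seq x i ℚ.+ ℚ.∣ seq x K ℚ.- seq x i ∣
      ≤⟨ ℚ.+-monoʳ-≤ (seq x i) (k K i (ℕ.m≤m⊔n M N) (ℕ.≤-trans (ℕ.m≤m⊔n M N) K≤i)) ⟩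
    seq x i ℚ.+ η                            ≡⟨ ℚ.+-comm (seq x i) η ⟩
    η ℚ.+ seq x i                            ∎))
  where
  open ℚ.≤-Reasoning
  K = M ℕ.⊔ N
...   | yes x≤2η = inj₂ (η , 0<η , K , λ i K≤i → +-cancel-≤ 3η η (seq y i) (begin
    3η ℚ.+ η                                 ≡⟨ ℚ.+-assoc (η ℚ.+ η) η η ⟩
    (η ℚ.+ η) ℚ.+ (η ℚ.+ η)                  ≤⟨ h i (ℕ.≤-trans (ℕ.m≤n⊔m M N) K≤i) ⟩
    seq x i ℚ.+ seq y i                      ≤⟨ ℚ.+-monoˡ-≤ (seq y i) (begin
      seq x i                                  ≤⟨ p≤q+∣p-q∣ (seq x i) (seq x K) ⟩
      seq x K ℚ.+ ℚ.∣ seq x i ℚ.- seq x K ∣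
        ≤⟨ ℚ.+-mono-≤ x≤2η (k i K (ℕ.≤-trans (ℕ.m≤m⊔n M N) K≤i) (ℕ.m≤m⊔n M N)) ⟩
      3η                                       ∎) ⟩
    3η ℚ.+ seq y i                           ∎))
  where
  open ℚ.≤-Reasoning
  K  = M ℕ.⊔ N
  3η = (η ℚ.+ η) ℚ.+ η

Positive-split : ∀ x y → Positive (x +ℝ y) → Positive x ⊎ Positive y
Positive-split x y (δ , 0<δ , N , h) =
  Positive-split-at x y (δ ℚ.* ½ ℚ.* ½) (0<half (0<half 0<δ))
    (N , λ i N≤i → subst (ℚ._≤ seq x i ℚ.+ seq y i) (sym quarters) (h i N≤i))
  where
  quarters : (δ ℚ.* ½ ℚ.* ½ ℚ.+ δ ℚ.* ½ ℚ.* ½) ℚ.+ (δ ℚ.* ½ ℚ.* ½ ℚ.+ δ ℚ.* ½ ℚ.* ½) ≡ δ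
  quarters = trans (cong₂ ℚ._+_ (half (δ ℚ.* ½)) (half (δ ℚ.* ½))) (half δ)

¬Positive-0 : ¬ Positive 0ℝ
¬Positive-0 (δ , 0<δ , N , h) = ℚ.<-irrefl refl (ℚ.<-≤-trans 0<δ (h N ℕ.≤-refl))

Positive-sum : (f : A → ℝ) → ∀ as → Positive (sum f as) → ∃ λ a → Positive (f a)
Positive-sum f []       pos = contradiction pos ¬Positive-0
Positive-sum f (a ∷ as) pos =
  [ (λ pos-a → a , pos-a) , Positive-sum f as ]′ (Positive-split (f a) (sum f as) pos)

-- If x is eventually at least δ, then below δ the minimum of x and y can only be y.
⊓≼0 : ∀ x y → Positive x → x ⊓ℝ y ≼ 0ℝ → y ≼ 0ℝ
⊓≼0 x y (δ , 0<δ , ev) (mk≼ h) = mk≼ λ ε 0<ε →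
  let ζ   = ε ℚ.⊓ (δ ℚ.* ½)
      0<ζ = ⊓-elim (0ℚ ℚ.<_) ε (δ ℚ.* ½) 0<ε (0<half 0<δ)
  in ev-zip (λ i δ≤x → ⊓-elim (λ q → q ℚ.≤ 0ℚ ℚ.+ ζ → seq y i ℚ.≤ 0ℚ ℚ.+ ε) (seq x i) (seq y i)
       (λ x≤ζ → contradiction (ℚ.<-≤-trans (ζ<δ ε) (ℚ.≤-trans δ≤x x≤ζ)) (ℚ.<-irrefl refl))
       (λ y≤ζ → ℚ.≤-trans y≤ζ (ℚ.+-monoʳ-≤ 0ℚ (ℚ.p⊓q≤p ε (δ ℚ.* ½)))))
     ev (h ζ 0<ζ)
  where
  ζ<δ : ∀ ε → 0ℚ ℚ.+ ε ℚ.⊓ (δ ℚ.* ½) ℚ.< δ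
  ζ<δ ε = begin-strict
    0ℚ ℚ.+ ε ℚ.⊓ (δ ℚ.* ½)     ≡⟨ ℚ.+-identityˡ _ ⟩
    ε ℚ.⊓ (δ ℚ.* ½)            ≤⟨ ℚ.p⊓q≤q ε (δ ℚ.* ½) ⟩
    δ ℚ.* ½                    ≡⟨ ℚ.+-identityʳ _ ⟨
    δ ℚ.* ½ ℚ.+ 0ℚ             <⟨ ℚ.+-monoʳ-< (δ ℚ.* ½) (0<half 0<δ) ⟩
    δ ℚ.* ½ ℚ.+ δ ℚ.* ½        ≡⟨ half δ ⟩
    δ                          ∎
    where open ℚ.≤-Reasoning

------------------------------------------------------------------------
-- Lists without repetitions

module _ {A : Set} {P : Pred A 0ℓ} (P? : Decidable P) where

  ∈-select⁻ : ∀ {y} xs → y ∈ select P? xs → proj₁ y ∈ xs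
  ∈-select⁻ (x ∷ xs) y∈ with P? x
  ∈-select⁻ (x ∷ xs) (here refl) | yes _ = here refl
  ∈-select⁻ (x ∷ xs) (there y∈)  | yes _ = there (∈-select⁻ xs y∈)
  ∈-select⁻ (x ∷ xs) y∈          | no _  = there (∈-select⁻ xs y∈)

  select-unique : ∀ {xs} → Unique xs → Unique (select P? xs)
  select-unique {[]}     []            = []
  select-unique {x ∷ xs} (x∉ ∷ uniq) with P? x
  ... | yes _ = All.tabulate (λ y∈ x≡y →
                  All.lookup x∉ (∈-select⁻ xs y∈) (cong proj₁ x≡y)) ∷ select-unique uniq
  ... | no  _ = select-unique uniq

Unique⇒lookup-injective : ∀ {A : Set} {xs : List A} → Unique xs →
  ∀ i j → lookup xs i ≡ lookup xs j → i ≡ j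
Unique⇒lookup-injective (x∉ ∷ u) zero    zero    eq = refl
Unique⇒lookup-injective (x∉ ∷ u) zero    (suc j) eq = contradiction eq (All.lookup x∉ (∈-lookup j))
Unique⇒lookup-injective (x∉ ∷ u) (suc i) zero    eq = contradiction (sym eq) (All.lookup x∉ (∈-lookup i))
Unique⇒lookup-injective (x∉ ∷ u) (suc i) (suc j) eq = cong suc (Unique⇒lookup-injective u i j eq)

------------------------------------------------------------------------
-- Edges

module _ {n : ℕ} (G : Graph n) where

  private
    variable
      a b s t t′ u v : Fin n

  -- The proof that a pair is an edge is unique.
  edge-≡ : {e f : Edge G} → proj₁ e ≡ proj₁ f → e ≡ f
  edge-≡ {uv , u<v , u~v} {_ , u<v′ , u~v′} refl =
    cong (uv ,_) (cong₂ _,_ (Fin.<-irrelevant u<v u<v′) (T-irrelevant u~v u~v′))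

  _≟ᴱ_ : DecidableEquality (Edge G)
  e ≟ᴱ f = map′ edge-≡ (cong proj₁) (≡-dec Fin._≟_ Fin._≟_ (proj₁ e) (proj₁ f))

  open DecMembership (Fin._≟_ {n}) using () renaming (_∈?_ to _∈ⱽ?_)
  open DecMembership _≟ᴱ_ using () renaming (_∈?_ to _∈ᴱ?_)

  edges-unique : Unique (edges G)
  edges-unique = select-unique (isEdge? G) (cartesianProduct⁺ (allFin⁺ n) (allFin⁺ n))

  edgeOf-self : (e : Edge G) → edgeOf G (proj₂ (proj₂ e)) ≡ e
  edgeOf-self ((u , v) , u<v , u~v) with Fin.<-cmp u v
  ... | tri< _ _ _    = edge-≡ refl
  ... | tri≈ _ refl _ = contradiction u~v (¬Adj-refl G)
  ... | tri> u≮v _ _  = contradiction u<v u≮v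

  edgeOf-sym : (h : Adj G u v) (k : Adj G v u) → edgeOf G h ≡ edgeOf G k
  edgeOf-sym {u} {v} h k with Fin.<-cmp u v | Fin.<-cmp v u
  ... | tri≈ _ refl _   | _               = contradiction h (¬Adj-refl G)
  ... | _               | tri≈ _ refl _   = contradiction h (¬Adj-refl G)
  ... | tri< _ _ _      | tri> _ _ _      = edge-≡ refl
  ... | tri> _ _ _      | tri< _ _ _      = edge-≡ refl
  ... | tri< _ _ v≮u    | tri< v<u _ _    = contradiction v<u v≮u
  ... | tri> u≮v _ _    | tri> _ _ u<v    = contradiction u<v u≮v

  edgeOf-ends : (h : Adj G u v) → proj₁ (edgeOf G h) ≡ (u , v) ⊎ proj₁ (edgeOf G h) ≡ (v , u)
  edgeOf-ends {u} {v} h with Fin.<-cmp u v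
  ... | tri< _ _ _    = inj₁ refl
  ... | tri≈ _ refl _ = contradiction h (¬Adj-refl G)
  ... | tri> _ _ _    = inj₂ refl

  edgeOf-injective : (h : Adj G u v) (k : Adj G a b) → edgeOf G h ≡ edgeOf G k →
                     (u ≡ a × v ≡ b) ⊎ (u ≡ b × v ≡ a)
  edgeOf-injective h k eq with edgeOf-ends h | edgeOf-ends k
  ... | inj₁ p | inj₁ q with refl ← trans (sym p) (trans (cong proj₁ eq) q) = inj₁ (refl , refl)
  ... | inj₁ p | inj₂ q with refl ← trans (sym p) (trans (cong proj₁ eq) q) = inj₂ (refl , refl)
  ... | inj₂ p | inj₁ q with refl ← trans (sym p) (trans (cong proj₁ eq) q) = inj₂ (refl , refl)
  ... | inj₂ p | inj₂ q with refl ← trans (sym p) (trans (cong proj₁ eq) q) = inj₁ (refl , refl)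

  ------------------------------------------------------------------------
  -- Walks and paths

  start∈ : (p : Walk G u v) → u ∈ vertices G p
  start∈ []      = here refl
  start∈ (_ ∷ _) = here refl

  end∈ : (p : Walk G u v) → v ∈ vertices G p
  end∈ []      = here refl
  end∈ (_ ∷ p) = there (end∈ p)

  ends∈ : (h : Adj G a b) (p : Walk G u v) → edgeOf G h ∈ walkEdges G p →
          a ∈ vertices G p × b ∈ vertices G p
  ends∈ h (k ∷ p) (here eq) with edgeOf-injective h k eq
  ... | inj₁ (refl , refl) = here refl , there (start∈ p)
  ... | inj₂ (refl , refl) = there (start∈ p) , here refl
  ends∈ h (k ∷ p) (there h∈) with ends∈ h p h∈
  ... | a∈ , b∈ = there a∈ , there b∈

  path-head : (h : Adj G u t) (p : Walk G t v) → IsPath G (h ∷ p) → u ∉ vertices G p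
  path-head h p (u∉ ∷ _) u∈ = All.lookup u∉ u∈ refl

  path-head-edge : (h : Adj G u t) (p : Walk G t v) → IsPath G (h ∷ p) →
                   edgeOf G h ∉ walkEdges G p
  path-head-edge h p path h∈ = path-head h p path (proj₁ (ends∈ h p h∈))

  walkEdges-unique : (p : Walk G u v) → IsPath G p → Unique (walkEdges G p)
  walkEdges-unique []      _ = []
  walkEdges-unique (h ∷ p) path@(_ ∷ path′) =
    All.tabulate (λ { e∈ refl → path-head-edge h p path e∈ }) ∷ walkEdges-unique p path′

  -- A path from a vertex to itself has no edges.
  closed-path : (p : Walk G u u) → IsPath G p → ∀ {e} → e ∉ walkEdges G p
  closed-path []      _ ()
  closed-path (h ∷ p) path _ = path-head h p path (end∈ p)

  -- The walk p does not use the edge e.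
  Avoids : Edge G → Walk G u v → Set
  Avoids e p = e ∉ walkEdges G p

  -- The reversal of p followed by q.
  reverseOnto : Walk G u v → Walk G u s → Walk G v s
  reverseOnto []      q = q
  reverseOnto (h ∷ p) q = reverseOnto p (Adj-sym G h ∷ q)

  -- The walk p followed by the reversal of q.
  _++ʳ_ : Walk G u v → Walk G s v → Walk G u s
  []      ++ʳ q = reverseOnto q []
  (h ∷ p) ++ʳ q = h ∷ (p ++ʳ q)

  reverseOnto-avoids : ∀ {e} (p : Walk G u v) (q : Walk G u s) →
                       Avoids e p → Avoids e q → Avoids e (reverseOnto p q)
  reverseOnto-avoids []      q e∉p e∉q = e∉q
  reverseOnto-avoids (h ∷ p) q e∉p e∉q =
    reverseOnto-avoids p (Adj-sym G h ∷ q) (λ e∈ → e∉p (there e∈))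
      λ { (here eq)  → e∉p (here (trans eq (edgeOf-sym (Adj-sym G h) h)))
        ; (there e∈) → e∉q e∈ }

  ++ʳ-avoids : ∀ {e} (p : Walk G u v) (q : Walk G s v) →
               Avoids e p → Avoids e q → Avoids e (p ++ʳ q)
  ++ʳ-avoids []      q e∉p e∉q = reverseOnto-avoids q [] e∉q λ ()
  ++ʳ-avoids (h ∷ p) q e∉p e∉q =
    λ { (here eq)  → e∉p (here eq)
      ; (there e∈) → ++ʳ-avoids p q (λ e∈ → e∉p (there e∈)) e∉q e∈ }

  -- The part of a path from one of its vertices t onwards.
  suffix : (p : Walk G u v) → IsPath G p → t ∈ vertices G p →
           Σ[ q ∈ Path G t v ] pathEdges G q ⊆ walkEdges G p
  suffix []      path (here refl) = ([] , path) , λ e∈ → e∈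
  suffix (h ∷ p) path (here refl) = (h ∷ p , path) , λ e∈ → e∈
  suffix (h ∷ p) (_ ∷ path) (there t∈) with suffix p path t∈
  ... | q , q⊆p = q , λ e∈ → there (q⊆p e∈)

  -- Every walk contains a path with the same ends: whenever the first vertex occurs
  -- again, the detour is cut out.
  toPath : (p : Walk G u v) → Σ[ q ∈ Path G u v ] pathEdges G q ⊆ walkEdges G p
  toPath []      = ([] , [] ∷ []) , λ e∈ → e∈
  toPath {u} (h ∷ p) with toPath p
  ... | (q , path) , q⊆p with u ∈ⱽ? vertices G q
  ...   | yes u∈ = let r , r⊆q = suffix q path u∈ in r , λ e∈ → there (q⊆p (r⊆q e∈))
  ...   | no  u∉ = (h ∷ q , All.tabulate (λ { t∈ refl → u∉ t∈ }) ∷ path) ,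
    λ { (here eq) → here eq ; (there e∈) → there (q⊆p e∈) }

  ------------------------------------------------------------------------
  -- Edges of acyclic graphs are bridges

  module _ (acyclic : Acyclic G) where

    -- A path from a to b is the edge ab itself or, with ab, closes up to a cycle.
    bridge : (h : Adj G a b) (p : Walk G a b) → edgeOf G h ∈ walkEdges G p
    bridge h p with toPath p
    ... | ([]         , _)    , _   = contradiction h (¬Adj-refl G)
    ... | (k ∷ []     , _)    , q⊆p with refl ← T-irrelevant h k = q⊆p (here refl)
    ... | (k ∷ l ∷ q  , path) , _   =
      contradiction (Adj-sym G h) (acyclic (k ∷ l ∷ q , path) (s≤s (s≤s z≤n)))

    bridge₂ : (h : Adj G a b) (p : Walk G a v) (q : Walk G b v) →
              Avoids (edgeOf G h) p → ¬ Avoids (edgeOf G h) q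
    bridge₂ h p q h∉p h∉q = ++ʳ-avoids p q h∉p h∉q (bridge h (p ++ʳ q))

    -- A path ending at a that uses the edge ab uses it last, so it reaches b without
    -- that edge.
    across : (h : Adj G a b) (p : Walk G u a) → IsPath G p → edgeOf G h ∈ walkEdges G p →
             Σ[ q ∈ Walk G u b ] Avoids (edgeOf G h) q
    across h (k ∷ p) path (here eq) with edgeOf-injective k h (sym eq)
    ... | inj₁ (refl , refl) = contradiction (end∈ p) (path-head k p path)
    ... | inj₂ (refl , refl) = [] , λ ()
    across h (k ∷ p) path@(_ ∷ path′) (there h∈) with across h p path′ h∈
    ... | q , h∉q = k ∷ q , λ
      { (here eq)   → path-head-edge k p path (subst (_∈ walkEdges G p) eq h∈)
      ; (there h∈q) → h∉q h∈q }

    -- Likewise from an end t of any other edge on such a path.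
    across-edge : (h : Adj G a b) (k : Adj G t t′) → edgeOf G h ≢ edgeOf G k →
                  (p : Walk G u a) → IsPath G p →
                  edgeOf G h ∈ walkEdges G p → edgeOf G k ∈ walkEdges G p →
                  Σ[ q ∈ Walk G t b ] Avoids (edgeOf G h) q
    across-edge h k h≢k (l ∷ p) path (here eq) (here eq′) = contradiction (trans eq (sym eq′)) h≢k
    across-edge h k h≢k (l ∷ p) path@(_ ∷ path′) (here eq) (there k∈) with edgeOf-injective l h (sym eq)
    ... | inj₁ (refl , refl) = contradiction (end∈ p) (path-head l p path)
    ... | inj₂ (refl , refl) = contradiction k∈ (closed-path p path′)
    across-edge h k h≢k (l ∷ p) (_ ∷ path) (there h∈) (there k∈) = across-edge h k h≢k p path h∈ k∈
    across-edge h k h≢k (l ∷ p) path@(_ ∷ path′) (there h∈) (here eq)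
      with edgeOf-injective k l eq | across h p path′ h∈
    ... | inj₂ (refl , refl) | r = r
    ... | inj₁ (refl , refl) | q , h∉q = l ∷ q , λ
      { (here eq′)  → h≢k (trans eq′ (sym eq))
      ; (there h∈q) → h∉q h∈q }

    -- Paths through the edges ab and tt′, one ending at a and one at b, would join t
    -- to b and to a by walks avoiding ab.
    ¬both-to-both-ends : (h : Adj G a b) (k : Adj G t t′) → edgeOf G h ≢ edgeOf G k →
              (p : Path G u a) → edgeOf G h ∈ pathEdges G p → edgeOf G k ∈ pathEdges G p →
              (q : Path G v b) → edgeOf G h ∈ pathEdges G q → ¬ edgeOf G k ∈ pathEdges G q
    ¬both-to-both-ends h k h≢k (p , path) h∈p k∈p (q , path′) h∈q k∈q
      with across-edge h k h≢k p path h∈p k∈p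
         | across-edge h′ k (λ eq → h≢k (trans h≡h′ eq)) q path′
             (subst (_∈ walkEdges G q) h≡h′ h∈q) k∈q
      where
      h′ = Adj-sym G h
      h≡h′ = edgeOf-sym h h′
    ... | r , h∉r | r′ , h′∉r′ = reverseOnto-avoids r′ r
      (λ h∈r′ → h′∉r′ (subst (_∈ walkEdges G r′) (edgeOf-sym h (Adj-sym G h)) h∈r′)) h∉r
      (bridge h (reverseOnto r′ r))

    -- An end v of e such that no path chosen by conn and ending at v uses both e and
    -- f: if such a path ends at a, none ends at b.
    separating-end : (conn : Connected G) (e f : Edge G) → e ≢ f →
      ∃ λ v → ∀ u → ¬ (e ∈ pathEdges G (conn u v) × f ∈ pathEdges G (conn u v))
    separating-end conn e@((a , b) , _ , h) f@(_ , _ , k) e≢f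
      with Fin.any? (λ u → (e ∈ᴱ? pathEdges G (conn u a)) ×-dec (f ∈ᴱ? pathEdges G (conn u a)))
    ... | no ¬both            = a , λ u both → ¬both (u , both)
    ... | yes (u , e∈p , f∈p) = b , λ v (e∈q , f∈q) →
      ¬both-to-both-ends h k (λ eq → e≢f (trans (sym (edgeOf-self e)) (trans eq (edgeOf-self f))))
        (conn u a) (to e e∈p) (to f f∈p) (conn v b) (to e e∈q) (to f f∈q)
      where
      to : ∀ g {es} → g ∈ es → edgeOf G (proj₂ (proj₂ g)) ∈ es
      to g = subst (_∈ _) (sym (edgeOf-self g))

    -- If some listed path to v from one end of e avoids e, then all paths to v from
    -- the other end use it.
    far-end : (e : Edge G) (v : Fin n) (ps : ∀ u → List (Path G u v)) →
      ∃ λ u → All (λ p → e ∈ pathEdges G p) (ps u)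
    far-end e@((a , b) , _ , h) v ps with All.all? (λ p → e ∈ᴱ? pathEdges G p) (ps a)
    ... | yes e∈a = a , e∈a
    ... | no ¬e∈a with find (¬All⇒Any¬ (λ p → e ∈ᴱ? pathEdges G p) (ps a) ¬e∈a)
    ...   | (p , _) , _ , e∉p = b , All.tabulate λ { {q , _} _ →
      decidable-stable (e ∈ᴱ? walkEdges G q) λ e∉q →
        bridge₂ h p q (subst (_∉ walkEdges G p) (sym (edgeOf-self e)) e∉p)
                      (subst (_∉ walkEdges G q) (sym (edgeOf-self e)) e∉q) }

------------------------------------------------------------------------
-- The number of edges of a tree

module _ {k : ℕ} (G : Graph (suc k)) (tree : IsTree G) where

  private
    toRoot : ∀ u → Path G u zero
    toRoot u = connected tree u zero

  -- A walk to the root from any other vertex is nonempty.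
  firstEdge : ∀ {i} → Walk G (suc i) zero → Edge G
  firstEdge (h ∷ _) = edgeOf G h

  -- The edge from the non-root vertex suc i towards the root zero.
  parentEdge : Fin k → Edge G
  parentEdge i = firstEdge (proj₁ (toRoot (suc i)))

  -- If the paths from two vertices to the root started with the same edge, they
  -- would continue from its two ends without using it again.
  parentEdge-injective : ∀ i j → parentEdge i ≡ parentEdge j → i ≡ j
  parentEdge-injective i j eq with toRoot (suc i) | toRoot (suc j)
  ... | h ∷ p , path | h′ ∷ q , path′ with edgeOf-injective G h h′ eq
  ...   | inj₁ (refl , _)    = refl
  ...   | inj₂ (refl , refl) = contradiction (path-head-edge G h p path)
    (bridge₂ G (acyclic tree) h q p (subst (_∉ walkEdges G q) (sym eq) (path-head-edge G h′ q path′)))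

  -- A path that uses an edge at its first vertex a starts with that edge.
  parentEdge-start : ∀ {a b} (h : Adj G a b) → edgeOf G h ∈ pathEdges G (toRoot a) →
                     ∃ λ i → parentEdge i ≡ edgeOf G h
  parentEdge-start {zero}  h h∈ =
    contradiction h∈ (closed-path G (proj₁ (toRoot zero)) (proj₂ (toRoot zero)))
  parentEdge-start {suc i} h h∈ = i , go (toRoot (suc i)) h∈
    where
    go : (p : Path G (suc i) zero) → edgeOf G h ∈ pathEdges G p → firstEdge (proj₁ p) ≡ edgeOf G h
    go (k ∷ p , path) (here eq)  = sym eq
    go (k ∷ p , path) (there h∈) = contradiction (proj₁ (ends∈ G h p h∈)) (path-head G k p path)

  parentEdge-surjective : ∀ e → ∃ λ i → parentEdge i ≡ e
  parentEdge-surjective e@((a , b) , _ , h)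
    with edgeOf G h ∈ᴱ? pathEdges G (toRoot a) | edgeOf G h ∈ᴱ? pathEdges G (toRoot b)
    where open DecMembership (_≟ᴱ_ G) using () renaming (_∈?_ to _∈ᴱ?_)
  ... | yes h∈a | _       = map₂ (λ eq → trans eq (edgeOf-self G e)) (parentEdge-start h h∈a)
  ... | no  h∉a | no  h∉b = contradiction h∉b (bridge₂ G (acyclic tree) h _ _ h∉a)
  ... | no  _   | yes h∈b =
    map₂ (λ eq → trans eq (trans (edgeOf-sym G h′ h) (edgeOf-self G e)))
         (parentEdge-start h′ (subst (_∈ _) (edgeOf-sym G h h′) h∈b))
    where h′ = Adj-sym G h

  ∣edges∣ : length (edges G) ≡ k
  ∣edges∣ = ℕ.≤-antisym
    (Fin.injective⇒≤ {f = λ l → proj₁ (parentEdge-surjective (lookup (edges G) l))}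
      λ {l} {l′} eq → Unique⇒lookup-injective (edges-unique G) l l′
        (trans (sym (proj₂ (parentEdge-surjective (lookup (edges G) l))))
        (trans (cong parentEdge eq) (proj₂ (parentEdge-surjective (lookup (edges G) l′))))))
    (Fin.injective⇒≤ {f = λ i → index (∈-edges G (parentEdge i))}
      λ {i} {j} eq → parentEdge-injective i j
        (trans (lookup-index (∈-edges G (parentEdge i)))
        (trans (cong (lookup (edges G)) eq) (sym (lookup-index (∈-edges G (parentEdge j)))))))

------------------------------------------------------------------------
-- Eccentricities

-- For any connected acyclic graph and any total weight c.
module _ (n : ℕ) .{{_ : NonZero n}} (T : Graph n) (acyc : Acyclic T) (conn : Connected T)
         (w : WeightFunction T) (c : ℝ) (total≈c : totalWeight T w ≈ℝ c) where

  open DecMembership (_≟ᴱ_ T) using () renaming (_∈?_ to _∈ᴱ?_)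
  open ≼-Reasoning

  private
    total av : ℝ
    total = sum (weight w) (edges T)
    av    = avec T conn w

    -- pathWeight written with sum, to which it is equal by definition.
    pw : ∀ {u v} → Path T u v → ℝ
    pw p = sum (weight w) (pathEdges T p)

    eccs : ℝ
    eccs = sum (ecc T conn w) (allFin n)

    consts : ℝ → ℝ
    consts x = sum (λ _ → x) (allFin n)

  0≼weight : ∀ e → 0ℝ ≼ weight w e
  0≼weight e = mk≼ (nonNeg w e)

  total≼c : total ≼ c
  total≼c = ≈⇒≼ {total} {c} total≈c

  c≼total : c ≼ total
  c≼total = ≈⇒≽ {total} {c} total≈c

  weight≼total : ∀ e → weight w e ≼ total
  weight≼total e = term⊑sum (weight w) 0≼weight (edges T) (∈-edges T e)

  pathWeight≼c : ∀ {u v} (p : Path T u v) → pw p ≼ c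
  pathWeight≼c p@(q , path) = begin
    pw p      ≲⟨ sum-⊆ (weight w) 0≼weight (pathEdges T p) (edges T)
                   (walkEdges-unique T q path) (λ {e} _ → ∈-edges T e) ⟩
    total     ≲⟨ total≼c ⟩
    c         ∎

  pathWeight+weight≼c : ∀ {u v} (p : Path T u v) e → e ∉ pathEdges T p → pw p +ℝ weight w e ≼ c
  pathWeight+weight≼c p@(q , path) e e∉p = begin
    pw p +ℝ weight w e    ≲⟨ +-comm-≼ (pw p) (weight w e) ⟩
    weight w e +ℝ pw p
      ≲⟨ sum-⊆ (weight w) 0≼weight (e ∷ pathEdges T p) (edges T)
           (All.tabulate (λ { f∈p refl → e∉p f∈p }) ∷ walkEdges-unique T q path)
           (λ {f} _ → ∈-edges T f) ⟩
    total                 ≲⟨ total≼c ⟩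
    c                     ∎

  dist≼pathWeight : ∀ u v → dist T conn w u v ≼ pw (conn u v)
  dist≼pathWeight u v = min≼head (pathWeight T w) (conn u v) (paths T u v)

  -- Holds by definition; substituting along it under _+ℝ_ spares a comparison of
  -- moduli of convergence.
  ecc≡max : ∀ v → ecc T conn w v ≡ maxℝ (List⁺.map (λ u → dist T conn w u v) (v List⁺.∷ allFin n))
  ecc≡max v = refl

  -- If all the chosen paths to v weigh at most c - m, so does the eccentricity of v.
  ecc-slack : ∀ v m → (∀ u → pw (conn u v) +ℝ m ≼ c) → ecc T conn w v +ℝ m ≼ c
  ecc-slack v m h = subst (λ x → x +ℝ m ≼ c) (sym (ecc≡max v))
    (max-lub-+ (λ u → dist T conn w u v) v m c
      (λ u → ≼-trans {dist T conn w u v +ℝ m} {pw (conn u v) +ℝ m} {c}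
        (∙-monoˡ {dist T conn w u v} {pw (conn u v)} m (dist≼pathWeight u v)) (h u))
      (allFin n))

  ecc≼c : ∀ v → ecc T conn w v ≼ c
  ecc≼c v = begin
    ecc T conn w v        ≲⟨ ∙-identityʳ-⊒ (ecc T conn w v) ⟩
    ecc T conn w v +ℝ 0ℝ  ≲⟨ ecc-slack v 0ℝ (λ u → begin
      pw (conn u v) +ℝ 0ℝ   ≲⟨ ∙-identityʳ-⊑ (pw (conn u v)) ⟩
      pw (conn u v)         ≲⟨ pathWeight≼c (conn u v) ⟩
      c                     ∎) ⟩
    c                     ∎

  avec≼c : av ≼ c
  avec≼c = begin
    av              ≲⟨ /-mono-≼ {eccs} {consts c} n (sum-mono ecc≼c (allFin n)) ⟩
    consts c /ℝ n   ≲⟨ avg-const-≼ n c ⟩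
    c               ∎

  -- If the average is at least c, no eccentricity is below c by more than 0.
  slack≼0 : c ≼ av → ∀ v m → ecc T conn w v +ℝ m ≼ c → m ≼ 0ℝ
  slack≼0 c≼av v m h = +-cancelˡ-≼ eccs m 0ℝ (begin
    eccs +ℝ m    ≲⟨ sum-slack ecc≼c m (allFin n) (∈-allFin v) h ⟩
    consts c     ≲⟨ /-cancel-≼ {consts c} {eccs} n (begin
      consts c /ℝ n   ≲⟨ avg-const-≼ n c ⟩
      c               ≲⟨ c≼av ⟩
      eccs /ℝ n       ∎) ⟩
    eccs         ≲⟨ ∙-identityʳ-⊒ eccs ⟩
    eccs +ℝ 0ℝ   ∎)

  -- Take the end v of e no chosen path to which uses both e and f: each of these
  -- paths leaves out the weight of e or that of f.
  min-weight≼0 : c ≼ av → ∀ e f → e ≢ f → weight w e ⊓ℝ weight w f ≼ 0ℝ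
  min-weight≼0 c≼av e f e≢f =
    slack≼0 c≼av v m (ecc-slack v m λ u → bound u (e ∈ᴱ? pathEdges T (conn u v)))
    where
    m = weight w e ⊓ℝ weight w f
    v = proj₁ (separating-end T acyc conn e f e≢f)
    ¬both = proj₂ (separating-end T acyc conn e f e≢f)
    bound : ∀ u → Dec (e ∈ pathEdges T (conn u v)) → pw (conn u v) +ℝ m ≼ c
    bound u (yes e∈p) = begin
      pw (conn u v) +ℝ m           ≲⟨ ∙-monoʳ {m} {weight w f} (pw (conn u v)) (x⊓y≼y (weight w e) (weight w f)) ⟩
      pw (conn u v) +ℝ weight w f  ≲⟨ pathWeight+weight≼c (conn u v) f (λ f∈p → ¬both u (e∈p , f∈p)) ⟩
      c                            ∎
    bound u (no e∉p) = begin
      pw (conn u v) +ℝ m           ≲⟨ ∙-monoʳ {m} {weight w e} (pw (conn u v)) (x⊓y≼x (weight w e) (weight w f)) ⟩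
      pw (conn u v) +ℝ weight w e  ≲⟨ pathWeight+weight≼c (conn u v) e e∉p ⟩
      c                            ∎

  heavy-edge : Positive c → c ≼ av → ∃ λ e → weight w e ≈ℝ c
  heavy-edge 0<c c≼av =
    let e , pos = Positive-sum (weight w) (edges T)
          (Positive-≼ {c} {total} 0<c c≼total)
    in e , ≼-antisym {weight w e} {c}
      (begin
        weight w e   ≲⟨ weight≼total e ⟩
        total        ≲⟨ total≼c ⟩
        c            ∎)
      (begin
        c            ≲⟨ c≼total ⟩
        total        ≲⟨ sum⊑term (weight w) (edges-unique T) (∈-edges T e)
                          (λ f e≢f → ⊓≼0 (weight w e) (weight w f) pos (min-weight≼0 c≼av e f e≢f)) ⟩
        weight w e   ∎)

  weight≼pathWeight : ∀ {u v} {p : Path T u v} {e} → e ∈ pathEdges T p → weight w e ≼ pathWeight T w p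
  weight≼pathWeight {p = p} = term⊑sum (weight w) 0≼weight (pathEdges T p)

  weight≼dist : ∀ e u v → All (λ p → e ∈ pathEdges T p) (conn u v ∷ paths T u v) →
                weight w e ≼ dist T conn w u v
  weight≼dist e u v (e∈p ∷ e∈ps) =
    min-glb (pathWeight T w) (conn u v) {weight w e} (weight≼pathWeight {p = conn u v} e∈p) (paths T u v)
      (All.map (λ {p} → weight≼pathWeight {p = p}) e∈ps)

  dist≼ecc : ∀ u v → dist T conn w u v ≼ ecc T conn w v
  dist≼ecc u v = ≼max (λ u → dist T conn w u v) v (allFin n) (∈-allFin u)

  -- By far-end, all paths to v from some end u of e use e.
  weight≼ecc : ∀ e v → weight w e ≼ ecc T conn w v
  weight≼ecc e v =
    let u , e∈ps = far-end T acyc e v (λ u → conn u v ∷ paths T u v) in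
    ≼-trans {weight w e} {dist T conn w u v} {ecc T conn w v} (weight≼dist e u v e∈ps) (dist≼ecc u v)

  weight≼avec : ∀ e → weight w e ≼ av
  weight≼avec e = begin
    weight w e                 ≲⟨ avg-const-≽ n (weight w e) ⟩
    consts (weight w e) /ℝ n
      ≲⟨ /-mono-≼ {consts (weight w e)} {eccs} n (sum-mono (weight≼ecc e) (allFin n)) ⟩
    av                         ∎

theorem3p2 : ∀ (n : ℕ) .{{_ : NonZero n}} → 2 ≤ n →
    (T : Graph n) (tree : IsTree T) (w : WeightFunction T) → Normalised T w →
    avec T (connected tree) w ≤ℝ fromℕ (n ∸ 1) ×
    ((avec T (connected tree) w ≈ℝ fromℕ (n ∸ 1)) ⇔
    (∃ λ (e : Edge T) → weight w e ≈ℝ fromℕ (n ∸ 1)))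
theorem3p2 (suc k) (s≤s (s≤s {n = l} _)) T tree w normalised =
  ≼⇒≤ av≼c , mk⇔
    (λ av≈c → heavy-edge (suc k) T (acyclic tree) (connected tree) w c total≈c
                (Positive-fromℕ l) (≈⇒≽ {av} {c} av≈c))
    (λ (e , we≈c) → ≼-antisym {av} {c} av≼c
      (≼-trans {c} {weight w e} {av} (≈⇒≽ {weight w e} {c} we≈c)
        (weight≼avec (suc k) T (acyclic tree) (connected tree) w c total≈c e)))
  where
  av = avec T (connected tree) w
  c = fromℕ k
  total≈c : totalWeight T w ≈ℝ c
  total≈c = subst (λ l → totalWeight T w ≈ℝ fromℕ l) (∣edges∣ T tree) normalised
  av≼c : av ≼ c
  av≼c = avec≼c (suc k) T (acyclic tree) (connected tree) w c total≈c
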